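{- For every integer $d\ge1$ and every $d$-SMNBP $Z$, there is a $d$-SMNBP $Z'$ with yardsticks that represents the same function as $Z$ (same variables and same set of satisfying assignments) and has at most $3|Z|$ edges.
   Context: A nondeterministic branching program (NBP) $Z$ is a directed acyclic graph, multiple edges allowed, with one source and one sink, some of whose edges are labelled with literals; $Var(Z)$ is the set of variables labelling edges. A path is consistent if it does not contain both a variable and its negation among its labels; $A(P)$ is the set of labels of $P$. A satisfying assignment of $Z$ is an assignment $S$ to $Var(Z)$ such that some consistent source-sink path $P$ has $A(P)\subseteq S$. $|Z|$ is the number of edges. $Z$ is monotone if no edge is labelled with a negative literal. A path is read-once if no two of its edges are labelled with the same variable. A $d$-SMNBP is a monotone NBP in which along every path each variable labels at most $d$ edges, and every source-sink path can be partitioned into at most $d$ edge-disjoint consecutive read-once subpaths. A $d$-SMNBP $Z$ has yardsticks if every source-sink path $P$ contains vertices $u_1,\dots,u_{a+1}$, $a\le d$, occurring on $P$ in this order, with $u_1$ the source and $u_{a+1}$ the sink, such that for every $1\le i\le a$, every path of $Z$ from $u_i$ to $u_{i+1}$ is read-once. -}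

module Defs where

open import Data.Nat using (ℕ; zero; suc; _+_; _*_; _≤_; _≡ᵇ_)
open import Data.Bool using (Bool; true; false; if_then_else_; not)
open import Data.Fin using (Fin; fromℕ; inject₁) renaming (zero to fzero; suc to fsuc)
open import Data.Maybe using (Maybe; just; nothing)
open import Data.List using (List; []; _∷_; map; length; concat; tabulate)
open import Data.List.Relation.Unary.All using (All)
open import Data.List.Relation.Binary.Sublist.Propositional using (_⊆_)
open import Data.Product using (Σ; ∃; _×_; _,_)
open import Relation.Binary.PropositionalEquality using (_≡_; _≢_)
open import Relation.Nullary using (¬_)
open import Function.Bundles using (_⇔_)

data Lit : Set where
  pos : ℕ → Lit
  neg : ℕ → Lit

var : Lit → ℕ
var (pos x) = x
var (neg x) = x

holds : (ℕ → Bool) → Lit → Set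
holds S (pos x) = S x ≡ true
holds S (neg x) = S x ≡ false

record Graph : Set where
  field
    n : ℕ
    m : ℕ
    src : Fin m → Fin n
    tgt : Fin m → Fin n
    label : Fin m → Maybe Lit
    source : Fin n
    sink : Fin n

module _ (Z : Graph) where
  open Graph Z

  data Path : Fin n → Fin n → Set where
    []  : ∀ {u} → Path u u
    step : ∀ {u v} (e : Fin m) → src e ≡ u → Path (tgt e) v → Path u v

  edges : ∀ {u v} → Path u v → List (Fin m)
  edges [] = []
  edges (step e _ p) = e ∷ edges p

  verts : ∀ {u v} → Path u v → List (Fin n)
  verts {u} [] = u ∷ []
  verts {u} (step e _ p) = u ∷ verts p

  labelsOf : List (Fin m) → List Lit
  labelsOf [] = []
  labelsOf (e ∷ es) with label e
  ... | nothing = labelsOf es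
  ... | just l  = l ∷ labelsOf es

  occ : ℕ → List (Fin m) → ℕ
  occ x es = go (labelsOf es)
    where
    go : List Lit → ℕ
    go [] = 0
    go (l ∷ ls) = (if var l ≡ᵇ x then 1 else 0) + go ls

  ReadOnce : List (Fin m) → Set
  ReadOnce es = ∀ x → occ x es ≤ 1

  Consistent : List (Fin m) → Set
  Consistent es = ∀ x → ¬ (pos x ∈L labelsOf es × neg x ∈L labelsOf es)
    where
    open import Data.List.Membership.Propositional renaming (_∈_ to _∈L_)

  InVar : ℕ → Set
  InVar x = Σ (Fin m) λ e → Σ Lit λ l → (label e ≡ just l) × (var l ≡ x)

  Sat : (ℕ → Bool) → Set
  Sat S = Σ (Path source sink) λ P → Consistent (edges P) × All (holds S) (labelsOf (edges P))

  Acyclic : Set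
  Acyclic = ∀ u (p : Path u u) → edges p ≡ []

  UniqueSource : Set
  UniqueSource = (∀ e → tgt e ≢ source) × (∀ v → (∀ e → tgt e ≢ v) → v ≡ source)

  UniqueSink : Set
  UniqueSink = (∀ e → src e ≢ sink) × (∀ v → (∀ e → src e ≢ v) → v ≡ sink)

  IsNBP : Set
  IsNBP = Acyclic × UniqueSource × UniqueSink

  Monotone : Set
  Monotone = ∀ e x → label e ≢ just (neg x)

  size : ℕ
  size = m

  IsSMNBP : ℕ → Set
  IsSMNBP d =
    IsNBP × Monotone
    × (∀ u v (p : Path u v) x → occ x (edges p) ≤ d)
    × (∀ (P : Path source sink) → Σ (List (List (Fin m))) λ segs →
         length segs ≤ d × concat segs ≡ edges P × All ReadOnce segs)

  HasYardsticks : ℕ → Set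
  HasYardsticks d = ∀ (P : Path source sink) →
    Σ ℕ λ a → Σ (Fin (suc a) → Fin n) λ u →
      a ≤ d × u fzero ≡ source × u (fromℕ a) ≡ sink
      × tabulate u ⊆ verts P
      × (∀ (i : Fin a) (q : Path (u (inject₁ i)) (u (fsuc i))) → ReadOnce (edges q))

SameFunction : Graph → Graph → Set
SameFunction Z Z' = (∀ x → InVar Z x ⇔ InVar Z' x) × (∀ S → Sat Z S ⇔ Sat Z' S)

{-# OPTIONS --safe #-}
module Submission where

open import Defs
open import Data.Nat using (ℕ; zero; suc; _+_; _*_; _≤_; _<_; _≤?_; _≡ᵇ_; z≤n; s≤s)
open import Data.Nat.Properties
  using (+-assoc; ≤-refl; ≤-reflexive; ≤-trans; ≤-antisym; <-irrefl; m≤m+n; m≤n+m;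
         m≤n⇒m<n∨m≡n; 1+n≰n; ≡ᵇ⇒≡)
open import Data.Bool using (Bool; true; false; if_then_else_; T)
open import Data.Fin using (Fin; _≟_; splitAt; join; combine; remQuot; inject₁; fromℕ)
  renaming (zero to fzero; suc to fsuc)
open import Data.Fin.Patterns using (0F; 1F; 2F)
open import Data.Fin.Properties
  using (all?; any?; splitAt-join; join-splitAt; remQuot-combine; combine-remQuot)
open import Data.Fin.Induction using (spo-wellFounded; spo-noetherian)
open import Data.Maybe using (Maybe; just; nothing)
open import Data.List
  using (List; []; _∷_; _++_; map; length; concat; concatMap; lookup; tabulate)
open import Data.List.Properties
  using (++-assoc; ++-identityʳ; ++-conicalʳ; ∷-injective; length-map; concatMap-++;
         map-tabulate; tabulate-lookup)
open import Data.List.Membership.Propositional using (_∈_)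
open import Data.List.Relation.Unary.Any using (here; there)
open import Data.List.Relation.Unary.All as All using (All; []; _∷_)
import Data.List.Relation.Unary.All.Properties as AllP
open import Data.List.Relation.Binary.Sublist.Propositional using (_⊆_; []; _∷_; _∷ʳ_)
open import Data.List.Relation.Binary.Sublist.Propositional.Properties using (map⁺)
open import Data.Product using (Σ; ∃; ∃₂; _×_; _,_; proj₁; proj₂)
open import Data.Sum using (_⊎_; inj₁; inj₂; [_,_]′)
open import Function using (_∘_; flip; mk⇔)
open import Induction.WellFounded using (WellFounded; Acc; acc)
open import Relation.Binary using (IsStrictPartialOrder)
open import Relation.Binary.PropositionalEquality
  using (_≡_; _≢_; refl; sym; trans; cong; cong₂; subst; subst₂; isEquivalence)
open import Relation.Nullary using (¬_; Dec; yes; no; contradiction)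
open import Relation.Nullary.Decidable using (map′; _×-dec_; _⊎-dec_; decidable-stable)
open import Relation.Unary using (Decidable)

-- Give a vertex or an edge the level k if k + 1 is the least number of read-once segments that
-- suffices for every path starting there. Levels do not increase along paths, and a path whose
-- edges all have the same level is read-once. Subdividing every edge into an unlabelled, a labelled
-- and an unlabelled one, with the two new vertices at the level of the edge, confines all drops of
-- level to unlabelled edges; each of these has an end of degree one on its side, which can serve
-- as a yardstick. At most d levels occur, hence at most d − 1 inner yardsticks on a path.

-- Splitting lists and searching for a least number.

++-split : ∀ {A : Set} (as {bs} cs {ds} : List A) → as ++ bs ≡ cs ++ ds →
           (∃ λ es → cs ≡ as ++ es × bs ≡ es ++ ds) ⊎ (∃ λ es → as ≡ cs ++ es × ds ≡ es ++ bs)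
++-split []       cs       eq   = inj₁ (cs , refl , eq)
++-split (a ∷ as) []       eq   = inj₂ (a ∷ as , refl , sym eq)
++-split (a ∷ as) (c ∷ cs) eq with ∷-injective eq
... | refl , eq′ with ++-split as cs eq′
...   | inj₁ (es , p , q) = inj₁ (es , cong (a ∷_) p , q)
...   | inj₂ (es , p , q) = inj₂ (es , cong (a ∷_) p , q)

-- A list has finitely many cut points. The recursion moves the cut past `x` by replacing `P` with
-- `P ∘ (x ∷_)`. Used to decide `Segmentable`.
splitting? : ∀ {A : Set} {P Q : List A → Set} → Decidable P → Decidable Q →
             ∀ xs → Dec (∃₂ λ ys zs → ys ++ zs ≡ xs × P ys × Q zs)
splitting? P? Q? [] =
  map′ (λ (p , q) → [] , [] , refl , p , q) (λ { ([] , [] , refl , p , q) → p , q }) (P? [] ×-dec Q? [])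
splitting? P? Q? (x ∷ xs) =
  map′ (λ { (inj₁ (p , q)) → [] , x ∷ xs , refl , p , q
          ; (inj₂ (ys , zs , refl , p , q)) → x ∷ ys , zs , refl , p , q })
       (λ { ([] , zs , refl , p , q) → inj₁ (p , q)
          ; (y ∷ ys , zs , refl , p , q) → inj₂ (ys , zs , refl , p , q) })
       ((P? [] ×-dec Q? (x ∷ xs)) ⊎-dec splitting? (P? ∘ (x ∷_)) Q? xs)

least : ∀ {P : ℕ → Set} → Decidable P → ∀ k → P k → ∃ λ j → P j × (∀ i → P i → j ≤ i)
least P? zero    p = 0 , p , λ _ _ → z≤n
least P? (suc k) p with P? 0
... | yes p₀ = 0 , p₀ , λ _ _ → z≤n
... | no ¬p₀ with least (P? ∘ suc) k p
...   | j , pⱼ , min = suc j , pⱼ , λ { zero p₀ → contradiction p₀ ¬p₀ ; (suc i) pᵢ → s≤s (min i pᵢ) }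

-- Occurrences of a variable along a list of edges.

count : ℕ → List Lit → ℕ
count x []       = 0
count x (l ∷ ls) = (if var l ≡ᵇ x then 1 else 0) + count x ls

count-++ : ∀ x ks ls → count x (ks ++ ls) ≡ count x ks + count x ls
count-++ x []       ls = refl
count-++ x (k ∷ ks) ls =
  trans (cong (_ +_) (count-++ x ks ls)) (sym (+-assoc (if var k ≡ᵇ x then 1 else 0) _ _))

count-absent : ∀ x ls → count x ls ≡ 0 ⊎ x ∈ map var ls
count-absent x []       = inj₁ refl
count-absent x (l ∷ ls) with var l ≡ᵇ x in eq
... | true  = inj₂ (here (sym (≡ᵇ⇒≡ (var l) x (subst T (sym eq) _))))
... | false with count-absent x ls
...   | inj₁ z = inj₁ z
...   | inj₂ i = inj₂ (there i)

-- The local helper of `occ` has no name outside Defs; it is reached by unification.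
mutual
  occ≡count : ∀ Z x es → occ Z x es ≡ count x (labelsOf Z es)
  occ≡count Z x es with labelsOf Z es
  ... | ls = helper≡count Z x es ls

  helper≡count : ∀ Z x es ls → _ ≡ count x ls
  helper≡count Z x es []       = refl
  helper≡count Z x es (l ∷ ls) = cong (_ +_) (helper≡count Z x es ls)

-- Occurrences depend on the label list only, so they can be compared between `Z` and its
-- subdivision, whose edges have a different type.
occ-cong : ∀ Z Z′ es es′ → labelsOf Z es ≡ labelsOf Z′ es′ → ∀ x → occ Z x es ≡ occ Z′ x es′
occ-cong Z Z′ es es′ eq x =
  trans (occ≡count Z x es) (trans (cong (count x) eq) (sym (occ≡count Z′ x es′)))

ReadOnce-cong : ∀ Z Z′ es es′ → labelsOf Z es ≡ labelsOf Z′ es′ → ReadOnce Z es → ReadOnce Z′ es′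
ReadOnce-cong Z Z′ es es′ eq ro x = subst (_≤ 1) (occ-cong Z Z′ es es′ eq x) (ro x)

labelsOf-++ : ∀ Z es fs → labelsOf Z (es ++ fs) ≡ labelsOf Z es ++ labelsOf Z fs
labelsOf-++ Z []       fs = refl
labelsOf-++ Z (e ∷ es) fs with Graph.label Z e
... | nothing = labelsOf-++ Z es fs
... | just l  = cong (l ∷_) (labelsOf-++ Z es fs)

-- Partitions into read-once segments.

module Segments (Z : Graph) where
  open Graph Z

  occ-++ : ∀ x es fs → occ Z x (es ++ fs) ≡ occ Z x es + occ Z x fs
  occ-++ x es fs
    rewrite occ≡count Z x (es ++ fs) | occ≡count Z x es | occ≡count Z x fs | labelsOf-++ Z es fs
    = count-++ x (labelsOf Z es) (labelsOf Z fs)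

  readOnce-prefix : ∀ es {fs} → ReadOnce Z (es ++ fs) → ReadOnce Z es
  readOnce-prefix es {fs} ro x = ≤-trans (m≤m+n _ _) (subst (_≤ 1) (occ-++ x es fs) (ro x))

  readOnce-suffix : ∀ es {fs} → ReadOnce Z (es ++ fs) → ReadOnce Z fs
  readOnce-suffix es {fs} ro x =
    ≤-trans (m≤n+m _ (occ Z x es)) (subst (_≤ 1) (occ-++ x es fs) (ro x))

  -- Only the finitely many variables occurring in `es` have to be tested; every other one has count
  -- zero.
  readOnce? : Decidable (ReadOnce Z)
  readOnce? es = map′ everywhere (λ ro → All.universal ro _)
    (All.all? (λ x → occ Z x es ≤? 1) (map var (labelsOf Z es)))
    where
    everywhere : All (λ x → occ Z x es ≤ 1) (map var (labelsOf Z es)) → ReadOnce Z es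
    everywhere ro x with count-absent x (labelsOf Z es)
    ... | inj₁ z = subst (_≤ 1) (sym (trans (occ≡count Z x es) z)) z≤n
    ... | inj₂ i = All.lookup ro i

  -- Exactly `k` segments, but empty ones are allowed, so this amounts to at most `k` segments.
  Segmentable : ℕ → List (Fin m) → Set
  Segmentable zero    es = es ≡ []
  Segmentable (suc k) es = ∃₂ λ fs gs → fs ++ gs ≡ es × ReadOnce Z fs × Segmentable k gs

  segmentable? : ∀ k → Decidable (Segmentable k)
  segmentable? zero    []       = yes refl
  segmentable? zero    (_ ∷ _)  = no λ ()
  segmentable? (suc k)          = splitting? readOnce? (segmentable? k)

  segmentable-concat : ∀ k segs → length segs ≤ k → All (ReadOnce Z) segs → Segmentable k (concat segs)
  segmentable-concat zero    []           _       _          = refl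
  segmentable-concat (suc k) []           _       _          =
    [] , [] , refl , (λ _ → z≤n) , segmentable-concat k [] z≤n []
  segmentable-concat (suc k) (seg ∷ segs) (s≤s h) (ro ∷ ros) =
    seg , concat segs , refl , ro , segmentable-concat k segs h ros

  segmentable-suffix : ∀ k es {fs} → Segmentable k (es ++ fs) → Segmentable k fs
  segmentable-suffix zero    []       s = s
  segmentable-suffix (suc k) es       (as , bs , eq , ro , s) with ++-split as es eq
  ... | inj₁ (gs , _ , refl)    = [] , _ , refl , (λ _ → z≤n) , segmentable-suffix k gs s
  ... | inj₂ (gs , refl , refl) = gs , bs , refl , readOnce-suffix es ro , s

  segmentable-prefix : ∀ k es {fs} → Segmentable k (es ++ fs) → Segmentable k es
  segmentable-prefix zero    []       s = refl
  segmentable-prefix (suc k) es       (as , bs , eq , ro , s) with ++-split as es eq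
  ... | inj₁ (gs , refl , refl) = as , gs , refl , ro , segmentable-prefix k gs s
  ... | inj₂ (gs , refl , refl) =
    es , [] , ++-identityʳ es , readOnce-prefix es ro , segmentable-prefix k [] s

  -- Either the first segment ends before `e`, and the other `k` segments cover `e ∷ fs`, or it
  -- contains `e` and hence has `es ++ e ∷ []` as a prefix.
  segmentable-cut : ∀ k es e fs → Segmentable (suc k) (es ++ e ∷ fs) →
                    ReadOnce Z (es ++ e ∷ []) ⊎ Segmentable k (e ∷ fs)
  segmentable-cut k es e fs (as , bs , eq , ro , s) with ++-split as es eq
  ... | inj₁ (gs , _ , refl)           = inj₂ (segmentable-suffix k gs s)
  ... | inj₂ ([] , refl , refl)        = inj₂ s
  ... | inj₂ (_ ∷ gs , refl , refl) =
    inj₁ (readOnce-prefix (es ++ e ∷ []) (subst (ReadOnce Z) (sym (++-assoc es (e ∷ []) gs)) ro))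

-- Paths and reachability in an acyclic program.

module Paths (Z : Graph) where
  open Graph Z

  infixr 5 _◅◅_
  _◅◅_ : ∀ {u v w} → Path Z u v → Path Z v w → Path Z u w
  []            ◅◅ q = q
  step e eq p   ◅◅ q = step e eq (p ◅◅ q)

  edges-◅◅ : ∀ {u v w} (p : Path Z u v) (q : Path Z v w) → edges Z (p ◅◅ q) ≡ edges Z p ++ edges Z q
  edges-◅◅ []           q = refl
  edges-◅◅ (step e _ p) q = cong (e ∷_) (edges-◅◅ p q)

  unsnoc : ∀ {u v} (p : Path Z u v) →
           edges Z p ≡ [] ⊎ ∃₂ λ e (q : Path Z u (src e)) → edges Z p ≡ edges Z q ++ e ∷ []
  unsnoc []              = inj₁ refl
  unsnoc (step e refl p) with unsnoc p
  ... | inj₁ eq           = inj₂ (e , [] , cong (e ∷_) eq)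
  ... | inj₂ (f , q , eq) = inj₂ (f , step e refl q , cong (e ∷_) eq)

module Reachability (Z : Graph) (nbp : IsNBP Z) where
  open Graph Z
  open Paths Z

  _⊏_ : Fin n → Fin n → Set
  u ⊏ v = Σ (Path Z u v) λ p → edges Z p ≢ []

  -- Irreflexivity is acyclicity. On a finite vertex set such an order is well-founded in both
  -- directions, which permits recursion along edges.
  ⊏-isStrictPartialOrder : IsStrictPartialOrder _≡_ _⊏_
  ⊏-isStrictPartialOrder = record
    { isEquivalence = isEquivalence
    ; irrefl        = λ { refl (p , ne) → ne (proj₁ nbp _ p) }
    ; trans         = λ { ([] , ne) _ → contradiction refl ne
                        ; (p@(step _ _ _) , _) (q , _) → p ◅◅ q , λ () }
    ; <-resp-≈      = (λ { refl r → r }) , (λ { refl r → r })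
    }

  edge-⊏ : ∀ e → src e ⊏ tgt e
  edge-⊏ e = step e refl [] , λ ()

  -- Going backwards along edges stops only at a vertex without incoming edges, which is the source.
  -- Together with `toSink` this extends any path to a source-sink path.
  fromSource : ∀ v → Path Z source v
  fromSource v = go v (spo-wellFounded ⊏-isStrictPartialOrder v)
    where
    go : ∀ v → Acc _⊏_ v → Path Z source v
    go v (acc rs) with any? (λ e → tgt e ≟ v)
    ... | yes (e , refl) = go (src e) (rs (edge-⊏ e)) ◅◅ step e refl []
    ... | no none with proj₂ (proj₁ (proj₂ nbp)) v (λ e eq → none (e , eq))
    ...   | refl = []

  ⊐-wellFounded : WellFounded (flip _⊏_)
  ⊐-wellFounded = spo-noetherian ⊏-isStrictPartialOrder

  toSink : ∀ v → Path Z v sink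
  toSink v = go v (⊐-wellFounded v)
    where
    go : ∀ v → Acc (flip _⊏_) v → Path Z v sink
    go v (acc rs) with any? (λ e → src e ≟ v)
    ... | yes (e , refl) = step e refl (go (tgt e) (rs (edge-⊏ e)))
    ... | no none with proj₂ (proj₂ (proj₂ nbp)) v (λ e eq → none (e , eq))
    ...   | refl = []

-- Levels of vertices and edges.

module Levels (Z : Graph) (d : ℕ) (smnbp : IsSMNBP Z (suc d)) where
  open Graph Z
  open Paths Z
  open Reachability Z (proj₁ smnbp)
  open Segments Z

  -- The list `es` holds the edges already traversed before reaching `v`: none for the level of a
  -- vertex, the edge itself for the level of an edge.
  AllSegmentable : Fin n → List (Fin m) → ℕ → Set
  AllSegmentable v es k = ∀ w (p : Path Z v w) → Segmentable k (es ++ edges Z p)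

  -- A path from `v` is empty or starts with one of finitely many edges; well-founded recursion
  -- appends that edge to `es`.
  allSegmentable? : ∀ k v es → Dec (AllSegmentable v es k)
  allSegmentable? k v = go v (⊐-wellFounded v)
    where
    go : ∀ v → Acc (flip _⊏_) v → ∀ es → Dec (AllSegmentable v es k)
    go v (acc rs) es = map′
      (λ { (s , f) _ []            → subst (Segmentable k) (sym (++-identityʳ es)) s
         ; (s , f) w (step e eq p) → subst (Segmentable k) (++-assoc es (e ∷ []) (edges Z p)) (f e eq w p) })
      (λ f → subst (Segmentable k) (++-identityʳ es) (f _ []) ,
             λ e eq w p → subst (Segmentable k) (sym (++-assoc es (e ∷ []) (edges Z p))) (f w (step e eq p)))
      (segmentable? k es ×-dec all? next?)
      where
      next? : ∀ e → Dec (src e ≡ v → AllSegmentable (tgt e) (es ++ e ∷ []) k)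
      next? e with src e ≟ v
      ... | no ¬eq   = yes λ eq → contradiction eq ¬eq
      ... | yes refl = map′ (λ f _ → f) (λ f → f refl) (go (tgt e) (rs (edge-⊏ e)) (es ++ e ∷ []))

  -- The path extends to a source-sink path, whose given partition restricts to any consecutive
  -- part.
  allSegmentable-bound : ∀ {u v} (q : Path Z u v) → AllSegmentable v (edges Z q) (suc d)
  allSegmentable-bound {u} {v} q w p = segmentable-prefix (suc d) _
    (segmentable-suffix (suc d) (edges Z a) whole)
    where
    a = fromSource u
    b = toSink w
    P = a ◅◅ (q ◅◅ p) ◅◅ b

    whole : Segmentable (suc d) (edges Z a ++ (edges Z q ++ edges Z p) ++ edges Z b)
    whole with proj₂ (proj₂ (proj₂ smnbp)) P
    ... | segs , short , eq , ro = subst (Segmentable (suc d))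
      (trans eq (trans (edges-◅◅ a _) (cong (edges Z a ++_)
        (trans (edges-◅◅ (q ◅◅ p) b) (cong (_++ edges Z b) (edges-◅◅ q p))))))
      (segmentable-concat (suc d) segs short ro)

  -- Shifted by one, so that levels range over 0, …, d even though the empty list is 0-segmentable.
  abstract
    minimum : ∀ {u v} (q : Path Z u v) →
              ∃ λ k → AllSegmentable v (edges Z q) (suc k) ×
                      (∀ i → AllSegmentable v (edges Z q) (suc i) → k ≤ i)
    minimum {v = v} q = least (λ k → allSegmentable? (suc k) v (edges Z q)) d (allSegmentable-bound q)

  vertexLevel : Fin n → ℕ
  vertexLevel v = proj₁ (minimum {v} [])

  edgeLevel : Fin m → ℕ
  edgeLevel e = proj₁ (minimum (step e refl []))

  edgeLevel-segmentable : ∀ e → AllSegmentable (tgt e) (e ∷ []) (suc (edgeLevel e))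
  edgeLevel-segmentable e = proj₁ (proj₂ (minimum (step e refl [])))

  edgeLevel-minimal : ∀ e i → AllSegmentable (tgt e) (e ∷ []) (suc i) → edgeLevel e ≤ i
  edgeLevel-minimal e = proj₂ (proj₂ (minimum (step e refl [])))

  vertexLevel-≤ : ∀ v → vertexLevel v ≤ d
  vertexLevel-≤ v = proj₂ (proj₂ (minimum {v} [])) d (allSegmentable-bound {v} [])

  edgeLevel-≤-src : ∀ e → edgeLevel e ≤ vertexLevel (src e)
  edgeLevel-≤-src e = edgeLevel-minimal e _ λ w p → proj₁ (proj₂ (minimum {src e} [])) w (step e refl p)

  tgt-≤-edgeLevel : ∀ e → vertexLevel (tgt e) ≤ edgeLevel e
  tgt-≤-edgeLevel e = proj₂ (proj₂ (minimum {tgt e} [])) (edgeLevel e)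
    λ w p → segmentable-suffix (suc (edgeLevel e)) (e ∷ []) (edgeLevel-segmentable e w p)

  -- If q⋯e were not read-once, then in every continuation the first segment would end before e,
  -- so that the part from e on would need one segment less, against the minimality of the level of e.
  readOnce-level : ∀ {u v} (p : Path Z u v) {i} → All (λ e → edgeLevel e ≡ i) (edges Z p) →
                   ReadOnce Z (edges Z p)
  readOnce-level p {i} all with unsnoc p
  ... | inj₁ eq = subst (ReadOnce Z) (sym eq) λ _ → z≤n
  -- `segmentable-cut` yields a separate disjunction for each continuation; assuming `¬ro` selects
  -- the second case in all of them at once.
  ... | inj₂ (e , q , eq) = decidable-stable (readOnce? (edges Z p)) λ ¬ro →
          refute i (≤-reflexive (sym last-level)) λ w r → cutoff ¬ro r (segmentable w r)
    where
    last-level : edgeLevel e ≡ i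
    last-level = All.head (AllP.++⁻ʳ (edges Z q) (subst (All _) eq all))

    -- The first edge has level `i`, and its bound covers every path that starts with it.
    first-bound : ∀ {u v} (p : Path Z u v) (all : All (λ e → edgeLevel e ≡ i) (edges Z p)) →
                  edges Z p ≢ [] → AllSegmentable v (edges Z p) (suc i)
    first-bound []              all        ne = contradiction refl ne
    first-bound (step f refl p) (refl ∷ _) ne w r =
      subst (Segmentable _) (cong (f ∷_) (edges-◅◅ p r)) (edgeLevel-segmentable f w (p ◅◅ r))

    q∷e : Path Z _ (tgt e)
    q∷e = q ◅◅ step e refl []

    q∷e≡p : edges Z q∷e ≡ edges Z p
    q∷e≡p = trans (edges-◅◅ q _) (sym eq)

    q∷e-nonempty : edges Z q∷e ≢ []
    q∷e-nonempty empty with () ← ++-conicalʳ (edges Z q) (e ∷ []) (trans (sym (edges-◅◅ q _)) empty)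

    segmentable : AllSegmentable (tgt e) (edges Z q ++ e ∷ []) (suc i)
    segmentable w r = subst (λ es → Segmentable (suc i) (es ++ edges Z r)) (trans q∷e≡p eq)
      (first-bound q∷e (subst (All _) (sym q∷e≡p) all) q∷e-nonempty w r)

    cutoff : ¬ ReadOnce Z (edges Z p) → ∀ {w} (r : Path Z (tgt e) w) →
             Segmentable (suc i) ((edges Z q ++ e ∷ []) ++ edges Z r) → Segmentable i (e ∷ edges Z r)
    cutoff ¬ro r s with segmentable-cut i (edges Z q) e (edges Z r)
                          (subst (Segmentable (suc i)) (++-assoc (edges Z q) _ _) s)
    ... | inj₁ ro = contradiction (subst (ReadOnce Z) (sym eq) ro) ¬ro
    ... | inj₂ s′ = s′

    -- Minimality speaks of positive numbers of segments only. For `j` zero, the nonempty list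
    -- `e ∷ []` would have to be empty.
    refute : ∀ j → j ≤ edgeLevel e → ¬ AllSegmentable (tgt e) (e ∷ []) j
    refute zero    _ all with () ← all _ []
    refute (suc j) h all = 1+n≰n (≤-trans h (edgeLevel-minimal e j all))

-- The subdivided program and its equivalence with the original one.

module Subdivision (Z : Graph) where
  open Graph Z

  data Vertex : Set where
    old     : Fin n → Vertex
    beg end : Fin m → Vertex

  data Edge : Set where
    ins mid out : Fin m → Edge

  start : Edge → Vertex
  start (ins e) = old (src e)
  start (mid e) = beg e
  start (out e) = end e

  target : Edge → Vertex
  target (ins e) = beg e
  target (mid e) = end e
  target (out e) = old (tgt e)

  literal : Edge → Maybe Lit
  literal (ins e) = nothing
  literal (mid e) = label e
  literal (out e) = nothing

  V# : ℕ
  V# = n + (m + m)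

  encodeV : Vertex → Fin V#
  encodeV (old v) = join n (m + m) (inj₁ v)
  encodeV (beg e) = join n (m + m) (inj₂ (join m m (inj₁ e)))
  encodeV (end e) = join n (m + m) (inj₂ (join m m (inj₂ e)))

  fromSum : Fin n ⊎ Fin (m + m) → Vertex
  fromSum (inj₁ v) = old v
  fromSum (inj₂ e) = [ beg , end ]′ (splitAt m e)

  decodeV : Fin V# → Vertex
  decodeV = fromSum ∘ splitAt n

  decodeV-encodeV : ∀ x → decodeV (encodeV x) ≡ x
  decodeV-encodeV (old v) rewrite splitAt-join n (m + m) (inj₁ v) = refl
  decodeV-encodeV (beg e)
    rewrite splitAt-join n (m + m) (inj₂ (join m m (inj₁ e))) | splitAt-join m m (inj₁ e) = refl
  decodeV-encodeV (end e)
    rewrite splitAt-join n (m + m) (inj₂ (join m m (inj₂ e))) | splitAt-join m m (inj₂ e) = refl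

  encodeV-injective : ∀ x y → encodeV x ≡ encodeV y → x ≡ y
  encodeV-injective x y eq =
    trans (sym (decodeV-encodeV x)) (trans (cong decodeV eq) (decodeV-encodeV y))

  encodeV-decodeV : ∀ x → encodeV (decodeV x) ≡ x
  encodeV-decodeV x with splitAt n x | join-splitAt n (m + m) x
  ... | inj₁ v | eq = eq
  ... | inj₂ e | eq with splitAt m e | join-splitAt m m e
  ...   | inj₁ _ | refl = eq
  ...   | inj₂ _ | refl = eq

  -- Pairing the kind with the original edge makes the edge number `3 * m` by definition, so the
  -- size bound is reflexivity.
  encodeE : Edge → Fin (3 * m)
  encodeE (ins e) = combine {3} 0F e
  encodeE (mid e) = combine {3} 1F e
  encodeE (out e) = combine {3} 2F e

  fromPair : Fin 3 × Fin m → Edge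
  fromPair (0F , e) = ins e
  fromPair (1F , e) = mid e
  fromPair (2F , e) = out e

  decodeE : Fin (3 * m) → Edge
  decodeE = fromPair ∘ remQuot {3} m

  decodeE-encodeE : ∀ f → decodeE (encodeE f) ≡ f
  decodeE-encodeE (ins e) = cong fromPair (remQuot-combine {3} 0F e)
  decodeE-encodeE (mid e) = cong fromPair (remQuot-combine {3} 1F e)
  decodeE-encodeE (out e) = cong fromPair (remQuot-combine {3} 2F e)

  encodeE-decodeE : ∀ f → encodeE (decodeE f) ≡ f
  encodeE-decodeE f = trans (encodeE-fromPair (remQuot m f)) (combine-remQuot {3} m f)
    where
    encodeE-fromPair : ∀ q → encodeE (fromPair q) ≡ combine {3} (proj₁ q) (proj₂ q)
    encodeE-fromPair (0F , e) = refl
    encodeE-fromPair (1F , e) = refl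
    encodeE-fromPair (2F , e) = refl

  Z′ : Graph
  Z′ = record
    { n      = V#
    ; m      = 3 * m
    ; src    = encodeV ∘ start ∘ decodeE
    ; tgt    = encodeV ∘ target ∘ decodeE
    ; label  = literal ∘ decodeE
    ; source = encodeV (old source)
    ; sink   = encodeV (old sink)
    }

  open Graph Z′ using () renaming (src to src′; tgt to tgt′)

  src′-encodeE : ∀ f → src′ (encodeE f) ≡ encodeV (start f)
  src′-encodeE f = cong (encodeV ∘ start) (decodeE-encodeE f)

  tgt′-encodeE : ∀ f → tgt′ (encodeE f) ≡ encodeV (target f)
  tgt′-encodeE f = cong (encodeV ∘ target) (decodeE-encodeE f)

  -- Paths of `Z′` on decoded vertices. One constructor per kind of edge lets pattern matching see
  -- that `mid` follows `ins` and `out` follows `mid`.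
  data Walk : Vertex → Vertex → Set where
    []  : ∀ {x} → Walk x x
    ins : ∀ {v y} e → src e ≡ v → Walk (beg e) y → Walk (old v) y
    mid : ∀ {y} e → Walk (end e) y → Walk (beg e) y
    out : ∀ {y} e → Walk (old (tgt e)) y → Walk (end e) y

  cons : ∀ f {y} → Walk (target f) y → Walk (start f) y
  cons (ins e) w = ins e refl w
  cons (mid e) w = mid e w
  cons (out e) w = out e w

  trail : ∀ {x y} → Walk x y → List Edge
  trail []          = []
  trail (ins e _ w) = ins e ∷ trail w
  trail (mid e w)   = mid e ∷ trail w
  trail (out e w)   = out e ∷ trail w

  trail-cons : ∀ f {y} (w : Walk (target f) y) → trail (cons f w) ≡ f ∷ trail w
  trail-cons (ins e) w = refl
  trail-cons (mid e) w = refl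
  trail-cons (out e) w = refl

  visits : ∀ {x y} → Walk x y → List Vertex
  visits {x} []          = x ∷ []
  visits {x} (ins _ _ w) = x ∷ visits w
  visits {x} (mid _ w)   = x ∷ visits w
  visits {x} (out _ w)   = x ∷ visits w

  visits-cons : ∀ f {y} (w : Walk (target f) y) → visits (cons f w) ≡ start f ∷ visits w
  visits-cons (ins e) w = refl
  visits-cons (mid e) w = refl
  visits-cons (out e) w = refl

  Represents : ∀ {x y u v} → Walk x y → Path Z′ u v → Set
  Represents w p = edges Z′ p ≡ map encodeE (trail w) × verts Z′ p ≡ map encodeV (visits w)

  toWalk : ∀ {u v} (p : Path Z′ u v) x y → encodeV x ≡ u → encodeV y ≡ v →
           Σ (Walk x y) λ w → Represents w p
  toWalk [] x y refl eq with encodeV-injective y x eq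
  ... | refl = [] , refl , refl
  toWalk (step f eq p) x y refl eq′ with encodeV-injective (start (decodeE f)) x eq
  ... | refl with toWalk p (target (decodeE f)) y refl eq′
  ...   | w , es , vs = cons (decodeE f) w ,
    trans (cong₂ _∷_ (sym (encodeE-decodeE f)) es) (cong (map encodeE) (sym (trail-cons (decodeE f) w))) ,
    trans (cong (_ ∷_) vs) (cong (map encodeV) (sym (visits-cons (decodeE f) w)))

  -- Contracts the `ins` and `out` edges, so that only `mid` edges survive in `projectW`.
  project : Vertex → Fin n
  project (old v) = v
  project (beg e) = src e
  project (end e) = tgt e

  projectW : ∀ {x y} → Walk x y → Path Z (project x) (project y)
  projectW []             = []
  projectW (ins e refl w) = projectW w
  projectW (mid e w)      = step e refl (projectW w)
  projectW (out e w)      = projectW w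

  labelsOf-trail : ∀ {x y} (w : Walk x y) →
                   labelsOf Z′ (map encodeE (trail w)) ≡ labelsOf Z (edges Z (projectW w))
  labelsOf-trail []             = refl
  labelsOf-trail (ins e refl w) rewrite decodeE-encodeE (ins e) = labelsOf-trail w
  labelsOf-trail (mid e w)      rewrite decodeE-encodeE (mid e) with label e
  ... | nothing = labelsOf-trail w
  ... | just l  = cong (l ∷_) (labelsOf-trail w)
  labelsOf-trail (out e w)      rewrite decodeE-encodeE (out e) = labelsOf-trail w

  represents-labels : ∀ {x y u v} {p : Path Z′ u v} (w : Walk x y) → Represents w p →
                      labelsOf Z′ (edges Z′ p) ≡ labelsOf Z (edges Z (projectW w))
  represents-labels w (es , _) = trans (cong (labelsOf Z′) es) (labelsOf-trail w)

  triple : Fin m → List (Fin (3 * m))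
  triple e = encodeE (ins e) ∷ encodeE (mid e) ∷ encodeE (out e) ∷ []

  -- Between old vertices every original edge is traversed as a complete triple, so a partition of
  -- the projected path expands to one of the walk.
  trail≡triples : ∀ {u v} (w : Walk (old u) (old v)) →
                  map encodeE (trail w) ≡ concatMap triple (edges Z (projectW w))
  trail≡triples []                            = refl
  trail≡triples (ins e refl (mid _ (out _ w))) = cong (triple e ++_) (trail≡triples w)

  labelsOf-triples : ∀ es → labelsOf Z′ (concatMap triple es) ≡ labelsOf Z es
  labelsOf-triples []       = refl
  labelsOf-triples (e ∷ es)
    rewrite decodeE-encodeE (ins e) | decodeE-encodeE (mid e) with label e
  ... | nothing rewrite decodeE-encodeE (out e) = labelsOf-triples es
  ... | just l  rewrite decodeE-encodeE (out e) = cong (l ∷_) (labelsOf-triples es)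

  -- The start `x` is given up to an equation because the target of an encoded edge equals
  -- `encodeV (old _)` only propositionally.
  lift : ∀ {u v x} (p : Path Z u v) → x ≡ encodeV (old u) →
         Σ (Path Z′ x (encodeV (old v))) λ q → edges Z′ q ≡ concatMap triple (edges Z p)
  lift []              refl = [] , refl
  lift (step e refl p) refl with lift p (tgt′-encodeE (out e))
  ... | q , eq =
    step (encodeE (ins e)) (src′-encodeE (ins e))
      (step (encodeE (mid e)) (trans (src′-encodeE (mid e)) (sym (tgt′-encodeE (ins e))))
        (step (encodeE (out e)) (trans (src′-encodeE (out e)) (sym (tgt′-encodeE (mid e)))) q)) ,
    cong (triple e ++_) eq

  -- Along unlabelled edges a walk can only move from end to old to beg.
  rank : Vertex → ℕ
  rank (end _) = 0
  rank (old _) = 1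
  rank (beg _) = 2

  rank-increases : ∀ {x y} (w : Walk x y) → edges Z (projectW w) ≡ [] → trail w ≡ [] ⊎ rank x < rank y
  rank-increases []             _ = inj₁ refl
  rank-increases (ins e refl []) _ = inj₂ ≤-refl
  rank-increases (out e w)      eq with w | rank-increases w eq
  ... | []          | _                 = inj₂ ≤-refl
  ... | ins _ _ _   | inj₂ lt           = inj₂ (≤-trans (s≤s z≤n) lt)

  module _ (nbp : IsNBP Z) where

    -- A closed walk projects to a closed path of `Z`, which is empty. Were the walk nonempty, it
    -- would strictly raise the rank, yet it returns to its start.
    acyclic′ : Acyclic Z′
    acyclic′ u p with toWalk p (decodeV u) (decodeV u) (encodeV-decodeV u) (encodeV-decodeV u)
    ... | w , es , _ with rank-increases w (proj₁ nbp _ (projectW w))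
    ...   | inj₁ eq = trans es (cong (map encodeE) eq)
    ...   | inj₂ lt = contradiction lt (<-irrefl refl)

    uniqueSource′ : UniqueSource Z′
    uniqueSource′ = noIn , only
      where
      noIn : ∀ f → tgt′ f ≢ encodeV (old source)
      noIn f eq with decodeE f | encodeV-injective (target (decodeE f)) (old source) eq
      ... | out e | refl = proj₁ (proj₁ (proj₂ nbp)) e refl

      only : ∀ v → (∀ f → tgt′ f ≢ v) → v ≡ encodeV (old source)
      only v none = trans (sym (encodeV-decodeV v)) (cases (decodeV v) λ f eq →
        none (encodeE f) (trans (tgt′-encodeE f) (trans (cong encodeV eq) (encodeV-decodeV v))))
        where
        cases : ∀ x → (∀ f → target f ≢ x) → encodeV x ≡ encodeV (old source)
        cases (old u) none = cong (encodeV ∘ old) (proj₂ (proj₁ (proj₂ nbp)) u λ e eq → none (out e) (cong old eq))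
        cases (beg e) none = contradiction refl (none (ins e))
        cases (end e) none = contradiction refl (none (mid e))

    uniqueSink′ : UniqueSink Z′
    uniqueSink′ = noOut , only
      where
      noOut : ∀ f → src′ f ≢ encodeV (old sink)
      noOut f eq with decodeE f | encodeV-injective (start (decodeE f)) (old sink) eq
      ... | ins e | refl = proj₁ (proj₂ (proj₂ nbp)) e refl

      only : ∀ v → (∀ f → src′ f ≢ v) → v ≡ encodeV (old sink)
      only v none = trans (sym (encodeV-decodeV v)) (cases (decodeV v) λ f eq →
        none (encodeE f) (trans (src′-encodeE f) (trans (cong encodeV eq) (encodeV-decodeV v))))
        where
        cases : ∀ x → (∀ f → start f ≢ x) → encodeV x ≡ encodeV (old sink)
        cases (old u) none = cong (encodeV ∘ old) (proj₂ (proj₂ (proj₂ nbp)) u λ e eq → none (ins e) (cong old eq))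
        cases (beg e) none = contradiction refl (none (mid e))
        cases (end e) none = contradiction refl (none (out e))

  isSMNBP′ : ∀ d → IsSMNBP Z d → IsSMNBP Z′ d
  isSMNBP′ d (nbp , monotone , bounded , segmented) =
    (acyclic′ nbp , uniqueSource′ nbp , uniqueSink′ nbp) , monotone′ , bounded′ , segmented′
    where
    monotone′ : Monotone Z′
    monotone′ f x eq with decodeE f
    ... | mid e = monotone e x eq

    bounded′ : ∀ u v (p : Path Z′ u v) x → occ Z′ x (edges Z′ p) ≤ d
    bounded′ u v p x with toWalk p (decodeV u) (decodeV v) (encodeV-decodeV u) (encodeV-decodeV v)
    ... | w , r = subst (_≤ d)
      (occ-cong Z Z′ (edges Z (projectW w)) (edges Z′ p) (sym (represents-labels w r)) x)
      (bounded _ _ (projectW w) x)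

    segmented′ : ∀ (P : Path Z′ _ _) → Σ (List (List (Fin (3 * m)))) λ segs →
                 length segs ≤ d × concat segs ≡ edges Z′ P × All (ReadOnce Z′) segs
    segmented′ P with toWalk P (old source) (old sink) refl refl
    ... | w , es , _ with segmented (projectW w)
    ...   | segs , short , eq , ro =
      -- Each segment of the projection is expanded into triples, which leaves its labels unchanged.
      map (concatMap triple) segs ,
      subst (_≤ d) (sym (length-map (concatMap triple) segs)) short ,
      trans (concat-triples segs) (trans (cong (concatMap triple) eq) (sym (trans es (trail≡triples w)))) ,
      AllP.map⁺ (All.map (λ {seg} →
        ReadOnce-cong Z Z′ seg (concatMap triple seg) (sym (labelsOf-triples seg))) ro)
      where
      concat-triples : ∀ segs → concat (map (concatMap triple) segs) ≡ concatMap triple (concat segs)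
      concat-triples []           = refl
      concat-triples (seg ∷ segs) =
        trans (cong (concatMap triple seg ++_) (concat-triples segs))
              (sym (concatMap-++ triple seg (concat segs)))

  -- The condition inside `Sat`, as a predicate of the label list, so that it can be transported
  -- along equal label lists.
  Satisfied : (ℕ → Bool) → List Lit → Set
  Satisfied S ls = (∀ x → ¬ (pos x ∈ ls × neg x ∈ ls)) × All (holds S) ls

  sameFunction : SameFunction Z Z′
  sameFunction = (λ x → mk⇔ (varTo x) (varFrom x)) , λ S → mk⇔ (satTo S) (satFrom S)
    where
    varTo : ∀ x → InVar Z x → InVar Z′ x
    varTo x (e , l , eq , v) = encodeE (mid e) , l , trans (cong literal (decodeE-encodeE (mid e))) eq , v

    varFrom : ∀ x → InVar Z′ x → InVar Z x
    varFrom x (f , l , eq , v) with decodeE f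
    ... | mid e = e , l , eq , v

    satTo : ∀ S → Sat Z S → Sat Z′ S
    satTo S (P , sat) with lift P refl
    ... | Q , eq = Q , subst (Satisfied S)
      (sym (trans (cong (labelsOf Z′) eq) (labelsOf-triples (edges Z P)))) sat

    satFrom : ∀ S → Sat Z′ S → Sat Z S
    satFrom S (Q , sat) with toWalk Q (old source) (old sink) refl refl
    ... | w , r = projectW w , subst (Satisfied S) (represents-labels w r) sat

-- Construction of the yardsticks.

module Yardsticks (Z : Graph) (d : ℕ) (smnbp : IsSMNBP Z (suc d)) where
  open Graph Z
  open Subdivision Z
  open Levels Z d smnbp

  level : Vertex → ℕ
  level (old v) = vertexLevel v
  level (beg e) = edgeLevel e
  level (end e) = edgeLevel e

  level-antitone : ∀ {x y} → Walk x y → level y ≤ level x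
  level-antitone []             = ≤-refl
  level-antitone (ins e refl w) = ≤-trans (level-antitone w) (edgeLevel-≤-src e)
  level-antitone (mid e w)      = level-antitone w
  level-antitone (out e w)      = ≤-trans (level-antitone w) (tgt-≤-edgeLevel e)

  -- All walks out of `x` or into `y` are considered, since a yardstick constrains every path
  -- between two consecutive ones and not only the given path.
  LevelsBelow LevelsAbove : Vertex → ℕ → Set
  LevelsBelow x i = ∀ e → Walk x (beg e) → edgeLevel e ≤ i
  LevelsAbove y i = ∀ e → Walk (end e) y → i ≤ edgeLevel e

  -- The two bounds force every original edge traversed to have level `i`, so `readOnce-level`
  -- applies.
  readOnce-between : ∀ {x y i} → LevelsBelow x i → LevelsAbove y i → (w : Walk x y) →
                     ReadOnce Z (edges Z (projectW w))
  readOnce-between {i = i} below above w = readOnce-level (projectW w) (constant below w)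
    where
    constant : ∀ {x} → LevelsBelow x i → (w : Walk x _) → All (λ e → edgeLevel e ≡ i) (edges Z (projectW w))
    constant below []             = []
    constant below (ins e refl w) = constant (λ f v → below f (ins e refl v)) w
    constant below (mid e w)      =
      ≤-antisym (below e []) (above e w) ∷ constant (λ f v → below f (mid e v)) w
    constant below (out e w)      = constant (λ f v → below f (out e v)) w

  -- The yardsticks still to come when the current level is `i`, ending with the sink. At each inner
  -- one the level drops from `i` to `j`.
  data Descent : ℕ → List Vertex → Set where
    last : ∀ {i} → LevelsAbove (old sink) i → Descent i (old sink ∷ [])
    next : ∀ {i j x xs} → LevelsAbove x i → LevelsBelow x j → j < i → Descent j xs → Descent i (x ∷ xs)

  -- Every inner yardstick lowers the level strictly, so there are at most `i` of them; the sink
  -- adds one.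
  descent-length : ∀ {i xs} → Descent i xs → length xs ≤ suc i
  descent-length (last _)        = s≤s z≤n
  descent-length (next _ _ lt D) = s≤s (≤-trans (descent-length D) lt)

  descent-sink : ∀ {i xs} → Descent i xs → ∀ x → lookup (x ∷ xs) (fromℕ (length xs)) ≡ old sink
  descent-sink (last _)       x = refl
  descent-sink (next _ _ _ D) x = descent-sink D _

  -- Here `x` is the yardstick just before `xs`; its upper bound on levels meets the lower bound at
  -- the head of `xs`.
  descent-readOnce : ∀ {i xs} → Descent i xs → ∀ x → LevelsBelow x i → (j : Fin (length xs))
                     (w : Walk (lookup (x ∷ xs) (inject₁ j)) (lookup (x ∷ xs) (fsuc j))) →
                     ReadOnce Z (edges Z (projectW w))
  descent-readOnce (last above)            x below fzero    w = readOnce-between below above w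
  descent-readOnce (next above below′ _ D) x below fzero    w = readOnce-between below above w
  descent-readOnce (next above below′ _ D) x below (fsuc j) w = descent-readOnce D _ below′ j w

  -- If the level drops along `out e`, then `end e` is a yardstick: its only outgoing edge leads to
  -- the lower level.
  descend-out : ∀ e {xs vs} → Descent (vertexLevel (tgt e)) xs → xs ⊆ vs →
                ∃ λ ys → Descent (edgeLevel e) ys × ys ⊆ end e ∷ vs
  descend-out e {xs} D sub with m≤n⇒m<n∨m≡n (tgt-≤-edgeLevel e)
  ... | inj₁ lt = end e ∷ xs ,
    next (λ _ w → level-antitone w) (λ { f (out _ w) → level-antitone w }) lt D , refl ∷ sub
  ... | inj₂ eq = xs , subst (λ i → Descent i xs) eq D , end e ∷ʳ sub

  -- If the level drops along `ins e`, then `beg e` is a yardstick: it can be entered only from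
  -- `old (src e)`, at the higher level.
  descend-ins : ∀ e {xs vs} → Descent (edgeLevel e) xs → xs ⊆ vs →
                ∃ λ ys → Descent (vertexLevel (src e)) ys × ys ⊆ beg e ∷ vs
  descend-ins e {xs} D sub with m≤n⇒m<n∨m≡n (edgeLevel-≤-src e)
  ... | inj₁ lt = beg e ∷ xs ,
    next above (λ _ w → level-antitone w) lt D , refl ∷ sub
    where
    above : LevelsAbove (beg e) (vertexLevel (src e))
    above f (out _ w) = ≤-trans (penultimate w) (tgt-≤-edgeLevel f)
      where
      -- The walk passes through `old (src e)` just before its end, and levels do not increase on
      -- the way there.
      penultimate : ∀ {v} → Walk (old v) (beg e) → vertexLevel (src e) ≤ vertexLevel v
      penultimate (ins _ refl [])                = ≤-refl
      penultimate (ins g refl (mid _ (out _ w))) =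
        ≤-trans (penultimate w) (≤-trans (tgt-≤-edgeLevel g) (edgeLevel-≤-src g))
  ... | inj₂ eq = xs , subst (λ i → Descent i xs) eq D , beg e ∷ʳ sub

  -- Yardsticks are collected from the sink backwards; each original edge contributes `end e` and
  -- `beg e` only where the level drops.
  descend : ∀ {v} (w : Walk (old v) (old sink)) → ∃ λ xs → Descent (vertexLevel v) xs × xs ⊆ visits w
  descend-step : ∀ e (w : Walk (old (tgt e)) (old sink)) →
                 ∃ λ xs → Descent (vertexLevel (src e)) xs × xs ⊆ beg e ∷ end e ∷ visits w

  descend []                             = old sink ∷ [] , last (λ _ w → level-antitone w) , refl ∷ []
  descend (ins e refl (mid _ (out _ w))) with descend-step e w
  ... | xs , D , sub = xs , D , _ ∷ʳ sub

  descend-step e w with descend w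
  ... | xs , D , sub with descend-out e D sub
  ...   | ys , D′ , sub′ = descend-ins e D′ sub′

  -- The starting vertex is to be put in front as the first yardstick. On the empty walk it
  -- coincides with the sink and is visited only once, hence the separate case.
  descend-from : ∀ {v} (w : Walk (old v) (old sink)) →
                 (old v ≡ old sink × old v ∷ [] ≡ visits w) ⊎
                 ∃ λ xs → Descent (vertexLevel v) xs × old v ∷ xs ⊆ visits w
  descend-from []                             = inj₁ (refl , refl)
  descend-from (ins e refl (mid _ (out _ w))) with descend-step e w
  ... | xs , D , sub = inj₂ (xs , D , refl ∷ sub)

  hasYardsticks : HasYardsticks Z′ (suc d)
  hasYardsticks P with toWalk P (old source) (old sink) refl refl
  ... | w , r with descend-from w
  -- Source and sink coincide: a single yardstick and no subpath.
  ...   | inj₁ (eq , vs) =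
    0 , (λ _ → encodeV (old source)) , z≤n , refl , cong encodeV eq ,
    subst (encodeV (old source) ∷ [] ⊆_) (sym (trans (proj₂ r) (cong (map encodeV) (sym vs)))) (refl ∷ []) ,
    λ ()
  ...   | inj₂ (xs , D , sub) =
    -- The source precedes `xs`, so there are `length xs` subpaths: at most one more than the level
    -- of the source, which is at most `d`.
    length xs , u , ≤-trans (descent-length D) (s≤s (vertexLevel-≤ source)) , refl ,
    cong encodeV (descent-sink D (old source)) ,
    subst₂ _⊆_ (sym tabulate-u) (sym (proj₂ r)) (map⁺ encodeV sub) ,
    segment
    where
    u : Fin (suc (length xs)) → Fin V#
    u = encodeV ∘ lookup (old source ∷ xs)

    tabulate-u : tabulate u ≡ map encodeV (old source ∷ xs)
    tabulate-u = trans (sym (map-tabulate (lookup (old source ∷ xs)) encodeV))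
                       (cong (map encodeV) (tabulate-lookup (old source ∷ xs)))

    segment : ∀ (i : Fin (length xs)) (q : Path Z′ (u (inject₁ i)) (u (fsuc i))) →
              ReadOnce Z′ (edges Z′ q)
    segment i q
      with toWalk q (lookup (old source ∷ xs) (inject₁ i)) (lookup (old source ∷ xs) (fsuc i)) refl refl
    ... | v , r = ReadOnce-cong Z Z′ (edges Z (projectW v)) (edges Z′ q) (sym (represents-labels v r))
      (descent-readOnce D (old source) (λ _ w → level-antitone w) i v)

theorem7 : (d : ℕ) → 1 ≤ d → (Z : Graph) → IsSMNBP Z d →
    Σ Graph λ Z' → IsSMNBP Z' d × HasYardsticks Z' d × SameFunction Z Z' × size Z' ≤ 3 * size Z
theorem7 (suc d) _ Z smnbp =
  Z′ , isSMNBP′ (suc d) smnbp , Yardsticks.hasYardsticks Z d smnbp , sameFunction , ≤-refl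
  where open Subdivision Z
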